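{- Let $G$ be a graph on $n$ vertices, and let $k_1,k_2$ be integers with $1\le k_1\le k_2\le n$. Let $L_{k_1}$ and $L_{k_2}$ be the Laplacian matrices of the token graphs $F_{k_1}(G)$ and $F_{k_2}(G)$, respectively, and let $B$ be the $(n;k_2,k_1)$-binomial matrix. Then $$B\,L_{k_1}=L_{k_2}\,B .$$
   Context: All graphs are finite and simple. For a graph $G$ with vertex set $[n]=\{1,\dots,n\}$ and $1\le k\le n$, the $k$-token graph $F_k(G)$ has as vertices the $k$-subsets of $[n]$; two vertices $A,B$ are adjacent iff $A\bigtriangleup B=\{a,b\}$ with $a\in A$, $b\in B$ and $\{a,b\}$ an edge of $G$. The Laplacian matrix of a graph is the diagonal degree matrix minus the adjacency matrix. The $(n;k_2,k_1)$-binomial matrix $B=B(n;k_2,k_1)$ is the $\binom n{k_2}\times\binom n{k_1}$ $(0,1)$-matrix with rows indexed by the $k_2$-subsets $A\subseteq[n]$ and columns indexed by the $k_1$-subsets $X\subseteq[n]$, with $B_{AX}=1$ if $X\subseteq A$ and $B_{AX}=0$ otherwise. The same orderings of the $k_1$-subsets and $k_2$-subsets are used for $B$, $L_{k_1}$, $L_{k_2}$. -}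

module Defs where

import Data.Bool.Properties as Bool
open import Data.Fin.Base using (Fin; zero)
open import Data.Fin.Properties as Fin using (any?; +↔⊎)
open import Data.Fin.Subset using (Subset; inside; outside; ∣_∣; _∈_; _∪_; _─_; ⁅_⁆)
open import Data.Fin.Subset.Properties using (_∈?_; _⊆?_; ∪-comm; x∈⁅x⁆; p⊆p∪q)
open import Data.Integer.Base as ℤ using (ℤ; 0ℤ; 1ℤ)
open import Data.Integer.Properties using (+-0-commutativeMonoid)
open import Data.Nat.Base using (ℕ; zero; suc)
open import Data.Nat.Combinatorics using (_C_; nCk+nC[k+1]≡[n+1]C[k+1])
open import Data.Nat.Properties as ℕ using (suc-injective)
open import Data.Product.Base using (Σ; ∃; _×_; _,_; proj₁)
open import Data.Sum.Base using (_⊎_; inj₁; inj₂)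
open import Data.Sum.Function.Propositional using (_⊎-↔_)
open import Data.Vec.Base using (_∷_; []; there; count; allFin)
open import Data.Vec.Properties using (≡-dec)
open import Function.Bundles using (_↔_; Inverse; mk↔ₛ′)
open import Function.Construct.Composition using (_↔-∘_)
open import Relation.Binary.Definitions using (Decidable; Symmetric; Irreflexive)
open import Relation.Binary.PropositionalEquality using (_≡_; refl; sym; trans; cong; subst)
open import Relation.Nullary using (¬_; Dec; yes; no)
open import Relation.Nullary.Decidable using (_×-dec_)

import Algebra.Properties.CommutativeMonoid.Sum as Sum
open Sum +-0-commutativeMonoid using (sum)

infixl 7 _⊗_
infixl 6 _⊖_ _△_

-- Simple graphs.  Adjacency is decidable so that matrix entries and degrees
-- can be computed; finiteness is supplied by an Ordering of V where needed.

record Graph (V : Set) : Set₁ where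
  field
    Adj        : V → V → Set
    adj?       : Decidable Adj
    adj-sym    : Symmetric Adj
    adj-irrefl : Irreflexive _≡_ Adj

-- An ordering v₁, …, v_N of all the elements of V, without repetition.

Ordering : ℕ → Set → Set
Ordering N V = Fin N ↔ V

Matrix : ℕ → ℕ → Set
Matrix m n = Fin m → Fin n → ℤ

_⊗_ : ∀ {l m n} → Matrix l m → Matrix m n → Matrix l n
(M ⊗ N) i j = sum (λ t → M i t ℤ.* N t j)

_⊖_ : ∀ {m n} → Matrix m n → Matrix m n → Matrix m n
(M ⊖ N) i j = M i j ℤ.- N i j

indicator : ∀ {P : Set} → Dec P → ℤ
indicator (yes _) = 1ℤ
indicator (no  _) = 0ℤ

module _ {V : Set} {N : ℕ} (G : Graph V) (σ : Ordering N V) where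
  open Graph G
  open Inverse σ using (to)

  degree : V → ℕ
  degree v = count (λ j → adj? v (to j)) (allFin N)

  adjacencyMatrix : Matrix N N
  adjacencyMatrix i j = indicator (adj? (to i) (to j))

  degreeMatrix : Matrix N N
  degreeMatrix i j with i Fin.≟ j
  ... | yes _ = ℤ.+ degree (to i)
  ... | no  _ = 0ℤ

  laplacian : Matrix N N
  laplacian = degreeMatrix ⊖ adjacencyMatrix

-- The vertex set [n] is represented by Fin n.

KSubset : ℕ → ℕ → Set
KSubset n k = Σ (Subset n) (λ A → ∣ A ∣ ≡ k)

_△_ : ∀ {n} → Subset n → Subset n → Subset n
A △ B = (A ─ B) ∪ (B ─ A)

module _ {n : ℕ} (G : Graph (Fin n)) (k : ℕ) where
  open Graph G using (Adj; adj?; adj-sym)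

  TokenAdj : KSubset n k → KSubset n k → Set
  TokenAdj (A , _) (B , _) =
    ∃ λ a → ∃ λ b → a ∈ A × b ∈ B × A △ B ≡ ⁅ a ⁆ ∪ ⁅ b ⁆ × Adj a b

  tokenAdj? : Decidable TokenAdj
  tokenAdj? (A , _) (B , _) = any? λ a → any? λ b →
    (a ∈? A) ×-dec (b ∈? B) ×-dec ≡-dec Bool._≟_ (A △ B) (⁅ a ⁆ ∪ ⁅ b ⁆) ×-dec adj? a b

  tokenSym : Symmetric TokenAdj
  tokenSym {A , _} {B , _} (a , b , a∈A , b∈B , eq , e) =
    b , a , b∈B , a∈A ,
    trans (∪-comm (B ─ A) (A ─ B)) (trans eq (∪-comm ⁅ a ⁆ ⁅ b ⁆)) ,
    adj-sym e

  private
    A△A-empty : ∀ {m} (A : Subset m) {x} → ¬ (x ∈ A △ A)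
    A△A-empty (inside  ∷ A) (there p) = A△A-empty A p
    A△A-empty (outside ∷ A) (there p) = A△A-empty A p

  tokenIrrefl : Irreflexive _≡_ TokenAdj
  tokenIrrefl {A , _} refl (a , b , _ , _ , eq , _) =
    A△A-empty A (subst (a ∈_) (sym eq) (p⊆p∪q ⁅ b ⁆ (x∈⁅x⁆ a)))

  tokenGraph : Graph (KSubset n k)
  tokenGraph = record
    { Adj = TokenAdj ; adj? = tokenAdj?
    ; adj-sym = λ {A} {B} → tokenSym {A} {B} ; adj-irrefl = tokenIrrefl }

binomialMatrix : ∀ (n k₂ k₁ : ℕ) →
                 Ordering (n C k₂) (KSubset n k₂) →
                 Ordering (n C k₁) (KSubset n k₁) →
                 Matrix (n C k₂) (n C k₁)
binomialMatrix n k₂ k₁ σ₂ σ₁ i j =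
  indicator (proj₁ (Inverse.to σ₁ j) ⊆? proj₁ (Inverse.to σ₂ i))

-- Orderings of the k-subsets indexed by Fin (n C k) exist, so quantifying
-- over them is not vacuous.

private
  KSubset-≡ : ∀ {n k} {A B : KSubset n k} → proj₁ A ≡ proj₁ B → A ≡ B
  KSubset-≡ {A = A , p} {B = .A , q} refl = cong (A ,_) (ℕ.≡-irrelevant p q)

  consOut : ∀ {n k} → KSubset n k → KSubset (suc n) k
  consOut (A , p) = outside ∷ A , p

  consIn : ∀ {n k} → KSubset n k → KSubset (suc n) (suc k)
  consIn (A , p) = inside ∷ A , cong suc p

  pascal : ∀ {n k} → (KSubset n k ⊎ KSubset n (suc k)) ↔ KSubset (suc n) (suc k)
  pascal {n} {k} = mk↔ₛ′ to from to∘from from∘to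
    where
    to : KSubset n k ⊎ KSubset n (suc k) → KSubset (suc n) (suc k)
    to (inj₁ A) = consIn A
    to (inj₂ A) = consOut A

    from : KSubset (suc n) (suc k) → KSubset n k ⊎ KSubset n (suc k)
    from (inside  ∷ A , p) = inj₁ (A , suc-injective p)
    from (outside ∷ A , p) = inj₂ (A , p)

    to∘from : ∀ A → to (from A) ≡ A
    to∘from (inside  ∷ A , p) = KSubset-≡ refl
    to∘from (outside ∷ A , p) = refl

    from∘to : ∀ A → from (to A) ≡ A
    from∘to (inj₁ A) = cong inj₁ (KSubset-≡ refl)
    from∘to (inj₂ A) = refl

  pascal₀ : ∀ {n} → KSubset n 0 ↔ KSubset (suc n) 0
  pascal₀ {n} = mk↔ₛ′ consOut from to∘from (λ _ → refl)
    where
    from : KSubset (suc n) 0 → KSubset n 0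
    from (outside ∷ A , p) = A , p

    to∘from : ∀ A → consOut (from A) ≡ A
    to∘from (outside ∷ A , p) = refl

kSubsetOrdering : ∀ n k → Ordering (n C k) (KSubset n k)
kSubsetOrdering zero zero =
  mk↔ₛ′ (λ _ → [] , refl) (λ _ → zero) (λ { ([] , p) → KSubset-≡ refl }) (λ { zero → refl })
kSubsetOrdering zero (suc k) =
  mk↔ₛ′ (λ ()) (λ { ([] , ()) }) (λ { ([] , ()) }) (λ ())
kSubsetOrdering (suc n) zero = pascal₀ ↔-∘ kSubsetOrdering n zero
kSubsetOrdering (suc n) (suc k) =
  subst (λ N → Ordering N (KSubset (suc n) (suc k))) (nCk+nC[k+1]≡[n+1]C[k+1] n k)
    (pascal ↔-∘ ((kSubsetOrdering n k ⊎-↔ kSubsetOrdering n (suc k)) ↔-∘ +↔⊎))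

-- A token graph Laplacian is a sum over edges of 1 − P_e, where P_e permutes
-- the subsets of [n] by the transposition τ of the end points of e.  Since
-- τ X ⊆ A iff X ⊆ τ A, the matrix B intertwines the operators P_e, hence the
-- Laplacians.  Sums over edges are written as sums over ordered pairs, so the
-- identities are obtained with a factor 2, which is cancelled at the end.

module Submission where

import Data.Bool.Properties as Bool
open import Data.Fin.Base using (Fin; zero; suc)
open import Data.Fin.Permutation as Perm using ()
open import Data.Fin.Permutation.Components using (transpose; transpose-inverse)
open import Data.Fin.Properties using (_≟_; any?; suc-injective)
open import Data.Fin.Subset using (Subset; inside; ∣_∣; _∈_; _∉_; _⊆_; _∪_; _─_; ⁅_⁆)
open import Data.Fin.Subset.Properties
  using (_∈?_; _⊆?_; ⊆-antisym; x∈p∪q⁻; x∈p∪q⁺; p─q⊆p; x∈p∧x∉q⇒x∈p─q; x∈⁅x⁆; x∈⁅y⁆⇒x≡y)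
open import Data.Integer.Base using (ℤ; +_; 0ℤ; 1ℤ; _+_; _*_; _-_; -_)
open import Data.Integer.Properties
  using (+-identityˡ; +-identityʳ; +-inverseʳ; +-injective; *-comm; *-zeroˡ;
         *-cancelˡ-≡; +-*-semiring)
open import Data.Integer.Tactic.RingSolver using (solve-∀)
open import Data.Nat.Base using (ℕ; _≤_)
open import Data.Nat.Combinatorics using (_C_)
import Data.Nat.Properties as ℕ
open import Data.Product.Base using (∃; ∃₂; _×_; _,_; proj₁; proj₂)
open import Data.Sum.Base using (_⊎_; inj₁; inj₂)
open import Data.Vec.Base using (_∷_; here; there; lookup; tabulate; count)
open import Data.Vec.Properties
  using (≡-dec; lookup∘tabulate; tabulate∘lookup; lookup⇒[]=; []=⇒lookup)
open import Function.Base using (_∘_; id)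
open import Function.Bundles using (Inverse)
open import Relation.Binary.PropositionalEquality
  using (_≡_; _≢_; refl; sym; trans; cong; cong₂; subst; module ≡-Reasoning)
open import Relation.Nullary using (¬_; Dec; yes; no; contradiction)
open import Relation.Nullary.Decidable using (_×-dec_; ¬?; dec-true; dec-false)
open import Relation.Unary using () renaming (Decidable to Decidable₁)
open import Defs

open import Algebra.Properties.Semiring.Sum +-*-semiring
  using (sum; ∑-distrib-+; ∑-comm; sum-permute; sum-cong-≗; sum-replicate-zero;
         *-distribʳ-sum; sum-syntax)

open ≡-Reasoning

-- Indicators and finite integer sums.

indicator-yes : ∀ {P : Set} (P? : Dec P) → P → indicator P? ≡ 1ℤ
indicator-yes (yes _) _ = refl
indicator-yes (no ¬p) p = contradiction p ¬p

indicator-no : ∀ {P : Set} (P? : Dec P) → ¬ P → indicator P? ≡ 0ℤ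
indicator-no (yes p) ¬p = contradiction p ¬p
indicator-no (no _)  _  = refl

indicator-⇔ : ∀ {P Q : Set} (P? : Dec P) (Q? : Dec Q) → (P → Q) → (Q → P) →
              indicator P? ≡ indicator Q?
indicator-⇔ (yes p) Q? f g = sym (indicator-yes Q? (f p))
indicator-⇔ (no ¬p) Q? f g = sym (indicator-no Q? (¬p ∘ g))

sum-zero : ∀ {n} (f : Fin n → ℤ) → (∀ i → f i ≡ 0ℤ) → sum f ≡ 0ℤ
sum-zero {n} f f≡0 = trans (sum-cong-≗ f≡0) (sum-replicate-zero n)

sum-single : ∀ {n} (f : Fin n → ℤ) i → (∀ j → j ≢ i → f j ≡ 0ℤ) → sum f ≡ f i
sum-single f zero f≡0 =
  trans (cong (λ s → f zero + s) (sum-zero (f ∘ suc) (λ j → f≡0 (suc j) λ ()))) (+-identityʳ _)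
sum-single f (suc i) f≡0 =
  trans (cong₂ _+_ (f≡0 zero λ ())
                   (sum-single (f ∘ suc) i (λ j j≢i → f≡0 (suc j) (j≢i ∘ suc-injective))))
        (+-identityˡ _)

-- Uniqueness of the witness leaves at most one nonzero term in the sum. This turns an existential
-- into an expression that can be multiplied and exchanged with other sums.
indicator-∃! : ∀ {n} {P : Set} {Q : Fin n → Set} (P? : Dec P) (Q? : ∀ i → Dec (Q i)) →
               (P → ∃ Q) → (∀ i → Q i → P) → (∀ i j → Q i → Q j → i ≡ j) →
               indicator P? ≡ ∑[ i < n ] indicator (Q? i)
indicator-∃! (yes p) Q? f g unique with f p
... | i , q = sym (trans
  (sum-single _ i (λ j j≢i → indicator-no (Q? j) (λ q′ → j≢i (unique j i q′ q))))
  (indicator-yes (Q? i) q))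
indicator-∃! (no ¬p) Q? f g unique =
  sym (sum-zero _ (λ i → indicator-no (Q? i) (¬p ∘ g i)))

-- Serves two counts: the degree of a vertex, and the size of a subset, since `∣_∣` is itself a
-- `count`.
count-tabulate : ∀ {A : Set} {P : A → Set} (P? : Decidable₁ P) {n} (f : Fin n → A) →
                 + count P? (tabulate f) ≡ ∑[ i < n ] indicator (P? (f i))
count-tabulate P? {ℕ.zero}  f = refl
count-tabulate P? {ℕ.suc n} f with P? (f zero)
... | yes _ = cong (λ s → 1ℤ + s) (count-tabulate P? (f ∘ suc))
... | no  _ = trans (count-tabulate P? (f ∘ suc)) (sym (+-identityˡ _))

-- The Laplacian of an arbitrary finite graph.

module _ {V : Set} {N : ℕ} (G : Graph V) (σ : Ordering N V) where
  open Graph G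
  open Inverse σ using (to)

  -- The degree is the row sum of the adjacency matrix, so the diagonal term distributes over the
  -- neighbours. In this form a summand vanishes wherever `f` takes its value at `i`.
  laplacian-row : ∀ i (f : Fin N → ℤ) →
    ∑[ t < N ] (laplacian G σ i t * f t) ≡
    ∑[ t < N ] (indicator (adj? (to i) (to t)) * (f i - f t))
  laplacian-row i f = begin
    sum (λ t → (D t - a t) * f t)
      ≡⟨ sum-cong-≗ (λ t → expand (D t) (a t) (f t)) ⟩
    sum (λ t → D t * f t + - a t * f t)
      ≡⟨ ∑-distrib-+ (λ t → D t * f t) (λ t → - a t * f t) ⟩
    sum (λ t → D t * f t) + sum (λ t → - a t * f t)
      ≡⟨ cong (_+ sum (λ t → - a t * f t)) diagonal ⟩
    sum (λ t → a t * f i) + sum (λ t → - a t * f t)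
      ≡⟨ ∑-distrib-+ (λ t → a t * f i) (λ t → - a t * f t) ⟨
    sum (λ t → a t * f i + - a t * f t)
      ≡⟨ sum-cong-≗ (λ t → collect (a t) (f i) (f t)) ⟩
    sum (λ t → a t * (f i - f t)) ∎
    where
    D a : Fin N → ℤ
    D = degreeMatrix G σ i
    a t = indicator (adj? (to i) (to t))

    expand : ∀ x y z → (x - y) * z ≡ x * z + - y * z
    expand = solve-∀

    collect : ∀ x y z → x * y + - x * z ≡ x * (y - z)
    collect = solve-∀

    off-diagonal : ∀ t → t ≢ i → D t * f t ≡ 0ℤ
    off-diagonal t t≢i with i ≟ t
    ... | yes i≡t = contradiction (sym i≡t) t≢i
    ... | no _    = *-zeroˡ (f t)

    on-diagonal : D i ≡ sum a
    on-diagonal with i ≟ i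
    ... | yes _  = count-tabulate (λ j → adj? (to i) (to j)) id
    ... | no i≢i = contradiction refl i≢i

    diagonal : sum (λ t → D t * f t) ≡ sum (λ t → a t * f i)
    diagonal = begin
      sum (λ t → D t * f t)  ≡⟨ sum-single _ i off-diagonal ⟩
      D i * f i              ≡⟨ cong (_* f i) on-diagonal ⟩
      sum a * f i            ≡⟨ *-distribʳ-sum (f i) a ⟩
      sum (λ t → a t * f i)  ∎

  -- Lets a column of the Laplacian be read as a row, the form in which it acts on functions.
  laplacian-sym : ∀ i j → laplacian G σ i j ≡ laplacian G σ j i
  laplacian-sym i j =
    cong₂ _-_ degree-sym (indicator-⇔ (adj? _ _) (adj? _ _) adj-sym adj-sym)
    where
    degree-sym : degreeMatrix G σ i j ≡ degreeMatrix G σ j i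
    degree-sym with i ≟ j | j ≟ i
    ... | yes refl | yes _  = refl
    ... | yes refl | no j≢i = contradiction refl j≢i
    ... | no i≢j | yes refl = contradiction refl i≢j
    ... | no _   | no _     = refl

-- Transpositions acting on points and on subsets.

module _ {n : ℕ} where

  transpose-left : ∀ (a b : Fin n) → transpose a b a ≡ b
  transpose-left a b rewrite dec-true (a ≟ a) refl = refl

  transpose-right : ∀ (a b : Fin n) → transpose a b b ≡ a
  transpose-right a b with b ≟ a
  ... | yes b≡a = b≡a
  ... | no _ rewrite dec-true (b ≟ b) refl = refl

  transpose-other : ∀ (a b : Fin n) {x} → x ≢ a → x ≢ b → transpose a b x ≡ x
  transpose-other a b {x} x≢a x≢b
    rewrite dec-false (x ≟ a) x≢a | dec-false (x ≟ b) x≢b = refl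

  transpose-comm : ∀ (a b x : Fin n) → transpose a b x ≡ transpose b a x
  transpose-comm a b x = by-cases (x ≟ a) (x ≟ b)
    where
    by-cases : Dec (x ≡ a) → Dec (x ≡ b) → transpose a b x ≡ transpose b a x
    by-cases (yes refl) _          = trans (transpose-left a b) (sym (transpose-right b a))
    by-cases (no _)     (yes refl) = trans (transpose-right a b) (sym (transpose-left b a))
    by-cases (no x≢a)   (no x≢b)   =
      trans (transpose-other a b x≢a x≢b) (sym (transpose-other b a x≢b x≢a))

  transpose-involutive : ∀ (a b x : Fin n) → transpose a b (transpose a b x) ≡ x
  transpose-involutive a b x =
    trans (cong (transpose a b) (transpose-comm a b x)) (transpose-inverse a b)

  -- Membership is precomposed with the transposition; as that is an involution, the result is also
  -- the image of `A` under it.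
  swap : Fin n → Fin n → Subset n → Subset n
  swap a b A = tabulate (λ i → lookup A (transpose a b i))

  ∈-swap⁺ : ∀ a b (A : Subset n) {x} → transpose a b x ∈ A → x ∈ swap a b A
  ∈-swap⁺ a b A {x} tx∈A = lookup⇒[]= x _ (trans (lookup∘tabulate _ x) ([]=⇒lookup tx∈A))

  ∈-swap⁻ : ∀ a b (A : Subset n) {x} → x ∈ swap a b A → transpose a b x ∈ A
  ∈-swap⁻ a b A {x} x∈ = lookup⇒[]= _ A (trans (sym (lookup∘tabulate _ x)) ([]=⇒lookup x∈))

  swap-comm : ∀ a b (A : Subset n) → swap a b A ≡ swap b a A
  swap-comm a b A = ⊆-antisym (half a b) (half b a)
    where
    half : ∀ a b → swap a b A ⊆ swap b a A
    half a b {x} x∈ = ∈-swap⁺ b a A (subst (_∈ A) (transpose-comm a b x) (∈-swap⁻ a b A x∈))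

  swap-fixed : ∀ a b (A : Subset n) → (a ∈ A → b ∈ A) → (b ∈ A → a ∈ A) → swap a b A ≡ A
  swap-fixed a b A a⇒b b⇒a =
    ⊆-antisym (λ {x} x∈ → to x (∈-swap⁻ a b A x∈))
              (λ {x} x∈A → ∈-swap⁺ a b A (to (transpose a b x)
                 (subst (_∈ A) (sym (transpose-involutive a b x)) x∈A)))
    where
    to : ∀ x → transpose a b x ∈ A → x ∈ A
    -- The case split makes `transpose a b x` compute, so `tx∈A` speaks of `b`, `a` or `x` in turn.
    to x tx∈A with x ≟ a
    ... | yes refl = b⇒a tx∈A
    ... | no _ with x ≟ b
    ...   | yes refl = a⇒b tx∈A
    ...   | no _     = tx∈A

  -- Applying the involution to both sides carries it across the inclusion. With the converse
  -- `⊆-swap`, this is the only property of inclusion, hence of `B`, on which the theorem rests.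
  swap-⊆ : ∀ a b (X A : Subset n) → swap a b X ⊆ A → X ⊆ swap a b A
  swap-⊆ a b X A τX⊆A {x} x∈X = ∈-swap⁺ a b A (τX⊆A (∈-swap⁺ a b X
    (subst (_∈ X) (sym (transpose-involutive a b x)) x∈X)))

  ⊆-swap : ∀ a b (X A : Subset n) → X ⊆ swap a b A → swap a b X ⊆ A
  ⊆-swap a b X A X⊆τA {x} x∈ =
    subst (_∈ A) (transpose-involutive a b x) (∈-swap⁻ a b A (X⊆τA (∈-swap⁻ a b X x∈)))

  -- A permutation of the points only reorders the sum of the membership indicators. Hence a swapped
  -- `k`-subset is again a vertex of the token graph.
  ∣swap∣ : ∀ a b (A : Subset n) → ∣ swap a b A ∣ ≡ ∣ A ∣
  ∣swap∣ a b A = +-injective (begin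
    + ∣ swap a b A ∣                              ≡⟨ count-tabulate (Bool._≟ inside) (lookup A ∘ transpose a b) ⟩
    sum (λ i → inside? (transpose a b i))         ≡⟨ sum-permute inside? (Perm.transpose a b) ⟨
    sum inside?                                   ≡⟨ count-tabulate (Bool._≟ inside) (lookup A) ⟨
    + ∣ tabulate (lookup A) ∣                     ≡⟨ cong (λ S → + ∣ S ∣) (tabulate∘lookup A) ⟩
    + ∣ A ∣                                       ∎)
    where
    inside? : Fin n → ℤ
    inside? i = indicator (lookup A i Bool.≟ inside)

-- Token adjacency as a transposition of an occupied and a free point.

∈─⇒∉ : ∀ {n} (p q : Subset n) {x} → x ∈ p ─ q → x ∉ q
∈─⇒∉ (_ ∷ p) (_ ∷ q)      (there x∈) (there x∈q) = ∈─⇒∉ p q x∈ x∈q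
∈─⇒∉ (_ ∷ p) (inside ∷ q) ()         here

∈△⁻ : ∀ {n} (A B : Subset n) {x} → x ∈ A △ B → (x ∈ A × x ∉ B) ⊎ (x ∈ B × x ∉ A)
∈△⁻ A B x∈ with x∈p∪q⁻ (A ─ B) (B ─ A) x∈
... | inj₁ x∈A─B = inj₁ (p─q⊆p A B x∈A─B , ∈─⇒∉ A B x∈A─B)
... | inj₂ x∈B─A = inj₂ (p─q⊆p B A x∈B─A , ∈─⇒∉ B A x∈B─A)

∈△⁺ : ∀ {n} (A B : Subset n) {x} → (x ∈ A × x ∉ B) ⊎ (x ∈ B × x ∉ A) → x ∈ A △ B
∈△⁺ A B (inj₁ (x∈A , x∉B)) = x∈p∪q⁺ (inj₁ (x∈p∧x∉q⇒x∈p─q x∈A x∉B))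
∈△⁺ A B (inj₂ (x∈B , x∉A)) = x∈p∪q⁺ (inj₂ (x∈p∧x∉q⇒x∈p─q x∈B x∉A))

∈pair⁻ : ∀ {n} {a b x : Fin n} → x ∈ ⁅ a ⁆ ∪ ⁅ b ⁆ → x ≡ a ⊎ x ≡ b
∈pair⁻ {a = a} {b} x∈ with x∈p∪q⁻ ⁅ a ⁆ ⁅ b ⁆ x∈
... | inj₁ x∈a = inj₁ (x∈⁅y⁆⇒x≡y a x∈a)
... | inj₂ x∈b = inj₂ (x∈⁅y⁆⇒x≡y b x∈b)

module _ {n : ℕ} {a b : Fin n} (A D : Subset n) where

  -- Both `a` and `b` lie in the symmetric difference, so `a ∈ A` forces `a ∉ D` and `b ∈ D` forces
  -- `b ∉ A`. Away from the pair, `A` and `D` agree.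
  △-pair⇒swap : a ≢ b → a ∈ A → b ∈ D → A △ D ≡ ⁅ a ⁆ ∪ ⁅ b ⁆ →
                b ∉ A × D ≡ swap a b A
  △-pair⇒swap a≢b a∈A b∈D eq =
    b∉A , ⊆-antisym (λ {x} x∈D → ∈-swap⁺ a b A (to x x∈D))
                    (λ {x} x∈ → from x (∈-swap⁻ a b A x∈))
    where
    a∉D : a ∉ D
    a∉D with ∈△⁻ A D (subst (a ∈_) (sym eq) (x∈p∪q⁺ (inj₁ (x∈⁅x⁆ a))))
    ... | inj₁ (_ , a∉D) = a∉D
    ... | inj₂ (_ , a∉A) = contradiction a∈A a∉A

    b∉A : b ∉ A
    b∉A with ∈△⁻ A D (subst (b ∈_) (sym eq) (x∈p∪q⁺ (inj₂ (x∈⁅x⁆ b))))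
    ... | inj₁ (_ , b∉D) = contradiction b∈D b∉D
    ... | inj₂ (_ , b∉A) = b∉A

    not-both : ∀ {x} → x ≢ a → x ≢ b → ¬ (x ∈ A △ D)
    not-both x≢a x≢b x∈ with ∈pair⁻ (subst (_ ∈_) eq x∈)
    ... | inj₁ x≡a = x≢a x≡a
    ... | inj₂ x≡b = x≢b x≡b

    to : ∀ x → x ∈ D → transpose a b x ∈ A
    to x x∈D with x ≟ a
    ... | yes refl = contradiction x∈D a∉D
    ... | no x≢a with x ≟ b
    ...   | yes refl = a∈A
    ...   | no x≢b with x ∈? A
    ...     | yes x∈A = x∈A
    ...     | no x∉A  = contradiction (∈△⁺ A D (inj₂ (x∈D , x∉A))) (not-both x≢a x≢b)

    from : ∀ x → transpose a b x ∈ A → x ∈ D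
    from x tx∈A with x ≟ a
    ... | yes refl = contradiction tx∈A b∉A
    ... | no x≢a with x ≟ b
    ...   | yes refl = b∈D
    ...   | no x≢b with x ∈? D
    ...     | yes x∈D = x∈D
    ...     | no x∉D  = contradiction (∈△⁺ A D (inj₁ (tx∈A , x∉D))) (not-both x≢a x≢b)

  -- With `a` occupied and `b` free, the transposition changes membership at exactly these two
  -- points.
  swap⇒△-pair : a ∈ A → b ∉ A → D ≡ swap a b A → b ∈ D × A △ D ≡ ⁅ a ⁆ ∪ ⁅ b ⁆
  swap⇒△-pair a∈A b∉A refl = b∈D , ⊆-antisym (λ {x} x∈ → to x (∈△⁻ A D x∈)) from
    where
    b∈D : b ∈ D
    b∈D = ∈-swap⁺ a b A (subst (_∈ A) (sym (transpose-right a b)) a∈A)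

    to : ∀ x → (x ∈ A × x ∉ D) ⊎ (x ∈ D × x ∉ A) → x ∈ ⁅ a ⁆ ∪ ⁅ b ⁆
    to x x∈ with x ≟ a | x ≟ b
    ... | yes refl | _        = x∈p∪q⁺ (inj₁ (x∈⁅x⁆ a))
    ... | no _     | yes refl = x∈p∪q⁺ (inj₂ (x∈⁅x⁆ b))
    ... | no x≢a   | no x≢b with x∈
    ...   | inj₁ (x∈A , x∉D) = contradiction
      (∈-swap⁺ a b A (subst (_∈ A) (sym (transpose-other a b x≢a x≢b)) x∈A)) x∉D
    ...   | inj₂ (x∈D , x∉A) = contradiction
      (subst (_∈ A) (transpose-other a b x≢a x≢b) (∈-swap⁻ a b A x∈D)) x∉A

    from : ⁅ a ⁆ ∪ ⁅ b ⁆ ⊆ A △ D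
    from x∈ with ∈pair⁻ x∈
    ... | inj₁ refl = ∈△⁺ A D (inj₁ (a∈A , λ a∈D →
      b∉A (subst (_∈ A) (transpose-left a b) (∈-swap⁻ a b A a∈D))))
    ... | inj₂ refl = ∈△⁺ A D (inj₂ (b∈D , b∉A))

-- The move can be read off from its result: `a` is the one element lost by `A`, and `b` the one
-- gained.
swap-injective : ∀ {n} {a b c d : Fin n} (A : Subset n) →
                 a ∈ A → b ∉ A → c ∈ A → d ∉ A →
                 swap a b A ≡ swap c d A → a ≡ c × b ≡ d
swap-injective {a = a} {b} {c} {d} A a∈A b∉A c∈A d∉A eq = a≡c , b≡d
  where
  a≡c : a ≡ c
  a≡c with a ≟ c
  ... | yes a≡c = a≡c
  -- Here `a` also differs from `d`, since `a ∈ A` and `d ∉ A`. So the second transposition keeps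
  -- `a`, while the first removes it.
  ... | no a≢c = contradiction
    (subst (_∈ A) (transpose-left a b) (∈-swap⁻ a b A (subst (a ∈_) (sym eq) a∈τA))) b∉A
    where
    a∈τA : a ∈ swap c d A
    a∈τA = ∈-swap⁺ c d A
      (subst (_∈ A) (sym (transpose-other c d a≢c λ { refl → d∉A a∈A })) a∈A)

  b≡d : b ≡ d
  b≡d with b ≟ d
  ... | yes b≡d = b≡d
  ... | no b≢d = contradiction
    (subst (_∈ A) (transpose-other c d (λ { refl → b∉A c∈A }) b≢d)
      (∈-swap⁻ c d A (subst (b ∈_) eq b∈τA))) b∉A
    where
    b∈τA : b ∈ swap a b A
    b∈τA = ∈-swap⁺ a b A (subst (_∈ A) (sym (transpose-right a b)) a∈A)

subset-ext : ∀ {n k} {A B : KSubset n k} → proj₁ A ≡ proj₁ B → A ≡ B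
subset-ext {A = A , _} refl = cong (A ,_) (ℕ.≡-irrelevant _ _)

-- Token moves and the Laplacian of a token graph.

module _ {n : ℕ} (G : Graph (Fin n)) where
  open Graph G

  -- A token of A can move along the edge from a to b.
  Move : Subset n → Fin n → Fin n → Set
  Move A a b = a ∈ A × b ∉ A × Adj a b

  move? : ∀ A a b → Dec (Move A a b)
  move? A a b = (a ∈? A) ×-dec ¬? (b ∈? A) ×-dec adj? a b

  MoveTo : Subset n → Subset n → Fin n → Fin n → Set
  MoveTo A D a b = Move A a b × D ≡ swap a b A

  moveTo? : ∀ A D a b → Dec (MoveTo A D a b)
  moveTo? A D a b = move? A a b ×-dec ≡-dec Bool._≟_ D (swap a b A)

  -- By `swap-injective` at most one pair of end points witnesses the adjacency, so `indicator-∃!`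
  -- applies twice, for `a` and then for `b`.
  tokenAdj-moves : ∀ {k} (A D : KSubset n k) →
    indicator (tokenAdj? G k A D) ≡
    ∑[ a < n ] ∑[ b < n ] indicator (moveTo? (proj₁ A) (proj₁ D) a b)
  tokenAdj-moves {k} 𝐀@(A , _) 𝐃@(D , _) = trans
    (indicator-∃! (tokenAdj? G k 𝐀 𝐃) (λ a → any? (moveTo? A D a)) to from
      λ { a c (b , m) (d , m′) → proj₁ (unique m m′) })
    (sum-cong-≗ λ a → indicator-∃! (any? (moveTo? A D a)) (moveTo? A D a)
      id (λ b m → b , m) (λ b d m m′ → proj₂ (unique m m′)))
    where
    to : TokenAdj G k 𝐀 𝐃 → ∃₂ (MoveTo A D)
    to (a , b , a∈A , b∈D , eq , e) =
      let b∉A , D≡ = △-pair⇒swap A D (λ a≡b → adj-irrefl a≡b e) a∈A b∈D eq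
      in a , b , (a∈A , b∉A , e) , D≡

    from : ∀ a → ∃ (MoveTo A D a) → TokenAdj G k 𝐀 𝐃
    from a (b , (a∈A , b∉A , e) , D≡) =
      let b∈D , eq = swap⇒△-pair A D a∈A b∉A D≡ in a , b , a∈A , b∈D , eq , e

    unique : ∀ {a b c d} → MoveTo A D a b → MoveTo A D c d → a ≡ c × b ≡ d
    unique ((a∈A , b∉A , _) , D≡) ((c∈A , d∉A , _) , D≡′) =
      swap-injective A a∈A b∉A c∈A d∉A (trans (sym D≡) D≡′)

  -- If exactly one of `a`, `b` lies in `A`, then for an edge exactly one orientation is a move, and
  -- both orientations name the same swapped set. If both or neither do, the swapped set is `A`
  -- itself, where `h` vanishes. Adding the orientations thus removes the membership conditions.
  moves-both-ways : ∀ (A : Subset n) (h : Subset n → ℤ) → h A ≡ 0ℤ → ∀ a b →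
    indicator (move? A a b) * h (swap a b A) + indicator (move? A b a) * h (swap b a A) ≡
    indicator (adj? a b) * h (swap a b A)
  moves-both-ways A h hA≡0 a b = by-cases (a ∈? A) (b ∈? A)
    where
    Goal : Set
    Goal = indicator (move? A a b) * h (swap a b A) + indicator (move? A b a) * h (swap b a A) ≡
           indicator (adj? a b) * h (swap a b A)

    zeros : ∀ x y z → x * 0ℤ + y * 0ℤ ≡ z * 0ℤ
    zeros = solve-∀

    fixed : (a ∈ A → b ∈ A) → (b ∈ A → a ∈ A) → Goal
    fixed a⇒b b⇒a rewrite swap-fixed a b A a⇒b b⇒a | swap-fixed b a A b⇒a a⇒b | hA≡0 =
      zeros (indicator (move? A a b)) (indicator (move? A b a)) (indicator (adj? a b))

    by-cases : Dec (a ∈ A) → Dec (b ∈ A) → Goal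
    by-cases (yes a∈A) (yes b∈A) = fixed (λ _ → b∈A) (λ _ → a∈A)
    by-cases (no a∉A)  (no b∉A)  =
      fixed (λ a∈A → contradiction a∈A a∉A) (λ b∈A → contradiction b∈A b∉A)
    by-cases (yes a∈A) (no b∉A)  = trans
      (cong₂ (λ x y → x * h (swap a b A) + y * h (swap b a A))
        (indicator-⇔ (move? A a b) (adj? a b) (proj₂ ∘ proj₂) (λ e → a∈A , b∉A , e))
        (indicator-no (move? A b a) (b∉A ∘ proj₁)))
      (+-identityʳ (indicator (adj? a b) * h (swap a b A)))
    by-cases (no a∉A)  (yes b∈A) = trans
      (cong₂ (λ x y → x * h (swap a b A) + y)
        (indicator-no (move? A a b) (a∉A ∘ proj₁))
        (cong₂ _*_
          (indicator-⇔ (move? A b a) (adj? a b)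
            (adj-sym ∘ proj₂ ∘ proj₂) (λ e → b∈A , a∉A , adj-sym e))
          (cong h (swap-comm b a A))))
      (+-identityˡ (indicator (adj? a b) * h (swap a b A)))

  module _ {k N : ℕ} (σ : Ordering N (KSubset n k)) where
    open Inverse σ using (to; from; strictlyInverseˡ; strictlyInverseʳ)

    private
      vertex : Fin N → Subset n
      vertex i = proj₁ (to i)

    -- Neighbours of a vertex correspond one to one to its legal moves, so the sum over vertices can
    -- be traded for a sum over ordered pairs of points.
    neighbour-sum : ∀ i (h : Subset n → ℤ) →
      ∑[ t < N ] (indicator (tokenAdj? G k (to i) (to t)) * h (vertex t)) ≡
      ∑[ a < n ] ∑[ b < n ] (indicator (move? (vertex i) a b) * h (swap a b (vertex i)))
    neighbour-sum i h = begin
      sum (λ t → indicator (tokenAdj? G k (to i) (to t)) * h (vertex t))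
        ≡⟨ sum-cong-≗ (λ t → trans
             (cong (_* h (vertex t)) (tokenAdj-moves (to i) (to t)))
             (trans (*-distribʳ-sum (h (vertex t)) (λ a → sum λ b → moveTo a b t))
               (sum-cong-≗ λ a → *-distribʳ-sum (h (vertex t)) (λ b → moveTo a b t)))) ⟩
      sum (λ t → sum λ a → sum λ b → moveTo a b t * h (vertex t))
        -- Where `moveTo a b t` is nonzero, `vertex t` is the swapped set, so the factor `h` ceases
        -- to depend on `t`.
        ≡⟨ sum-cong-≗ (λ t → sum-cong-≗ λ a → sum-cong-≗ λ b → replace a b t) ⟩
      sum (λ t → sum λ a → sum λ b → moveTo a b t * h (swap a b A))
        ≡⟨ ∑-comm (λ t a → sum λ b → moveTo a b t * h (swap a b A)) ⟩
      sum (λ a → sum λ t → sum λ b → moveTo a b t * h (swap a b A))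
        ≡⟨ sum-cong-≗ (λ a → ∑-comm (λ t b → moveTo a b t * h (swap a b A))) ⟩
      sum (λ a → sum λ b → sum λ t → moveTo a b t * h (swap a b A))
        -- The ordering lists the swapped set exactly once, so the sum over `t` is 1 for a legal
        -- move and 0 otherwise.
        ≡⟨ sum-cong-≗ (λ a → sum-cong-≗ λ b → trans
             (sym (*-distribʳ-sum (h (swap a b A)) (moveTo a b)))
             (cong (_* h (swap a b A)) (sym (target a b)))) ⟩
      sum (λ a → sum λ b → indicator (move? A a b) * h (swap a b A)) ∎
      where
      A : Subset n
      A = vertex i

      moveTo : Fin n → Fin n → Fin N → ℤ
      moveTo a b t = indicator (moveTo? A (vertex t) a b)

      replace : ∀ a b t → moveTo a b t * h (vertex t) ≡ moveTo a b t * h (swap a b A)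
      replace a b t with moveTo? A (vertex t) a b
      ... | yes (_ , eq) = cong (λ S → 1ℤ * h S) eq
      ... | no _         = refl

      target : ∀ a b → indicator (move? A a b) ≡ sum (moveTo a b)
      target a b = indicator-∃! (move? A a b) (λ t → moveTo? A (vertex t) a b)
        (λ m → from τA , m , cong proj₁ (strictlyInverseˡ τA))
        (λ t → proj₁)
        (λ s t (_ , eq) (_ , eq′) → trans (sym (strictlyInverseʳ s))
          (trans (cong from (subset-ext (trans eq (sym eq′)))) (strictlyInverseʳ t)))
        where
        τA : KSubset n k
        τA = swap a b A , trans (∣swap∣ a b A) (proj₂ (to i))

    -- An edge gives two ordered pairs on the right but at most one move on the left, whence the
    -- factor 2. The right side depends on `k` and `σ` only through `vertex i`, which makes
    -- Laplacians for different `k` comparable.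
    laplacian-edges : ∀ i (f : Subset n → ℤ) →
      + 2 * ∑[ t < N ] (laplacian (tokenGraph G k) σ i t * f (vertex t)) ≡
      ∑[ a < n ] ∑[ b < n ]
        (indicator (adj? a b) * (f (vertex i) - f (swap a b (vertex i))))
    laplacian-edges i f = begin
      + 2 * sum (λ t → laplacian (tokenGraph G k) σ i t * f (vertex t))
        ≡⟨ cong (+ 2 *_) (trans (laplacian-row (tokenGraph G k) σ i (f ∘ vertex))
                                (neighbour-sum i h)) ⟩
      + 2 * sum (λ a → sum (m a))
        ≡⟨ double (sum (λ a → sum (m a))) ⟩
      sum (λ a → sum (m a)) + sum (λ a → sum (m a))
        -- Exchanging the summation order in the second copy makes opposite orientations meet in one
        -- summand, as `moves-both-ways` requires.
        ≡⟨ cong (λ s → sum (λ a → sum (m a)) + s) (∑-comm m) ⟩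
      sum (λ a → sum (m a)) + sum (λ a → sum (λ b → m b a))
        ≡⟨ ∑-distrib-+ (λ a → sum (m a)) (λ a → sum (λ b → m b a)) ⟨
      sum (λ a → sum (m a) + sum (λ b → m b a))
        ≡⟨ sum-cong-≗ (λ a → trans
             (sym (∑-distrib-+ (m a) (λ b → m b a)))
             (sum-cong-≗ (moves-both-ways A h (+-inverseʳ (f A)) a))) ⟩
      sum (λ a → sum λ b → indicator (adj? a b) * h (swap a b A)) ∎
      where
      A : Subset n
      A = vertex i

      h : Subset n → ℤ
      h S = f A - f S

      m : Fin n → Fin n → ℤ
      m a b = indicator (move? A a b) * h (swap a b A)

      double : ∀ x → + 2 * x ≡ x + x
      double = solve-∀

-- Intertwining of the two Laplacians by inclusion of subsets.

theorem4p3 :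
    ∀ (n : ℕ) (G : Graph (Fin n)) (k₁ k₂ : ℕ) →
    1 ≤ k₁ → k₁ ≤ k₂ → k₂ ≤ n →
    (σ₁ : Ordering (n C k₁) (KSubset n k₁)) →
    (σ₂ : Ordering (n C k₂) (KSubset n k₂)) →
    let L₁ = laplacian (tokenGraph G k₁) σ₁
        L₂ = laplacian (tokenGraph G k₂) σ₂
        B  = binomialMatrix n k₂ k₁ σ₂ σ₁
    in ∀ (A : Fin (n C k₂)) (X : Fin (n C k₁)) →
       (B ⊗ L₁) A X ≡ (L₂ ⊗ B) A X
theorem4p3 n G k₁ k₂ _ _ _ σ₁ σ₂ A X = *-cancelˡ-≡ (+ 2) _ _ (begin
  + 2 * sum (λ t → B A t * L₁ t X)
    -- By symmetry column `X` of `L₁` becomes its row `X`, acting on the function that tests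
    -- containment in the fixed set `A′`.
    ≡⟨ cong (+ 2 *_) (sum-cong-≗ λ t → trans (*-comm (B A t) (L₁ t X))
         (cong (_* B A t) (laplacian-sym (tokenGraph G k₁) σ₁ t X))) ⟩
  + 2 * sum (λ t → L₁ X t * B A t)
    ≡⟨ laplacian-edges G σ₁ X (λ S → indicator (S ⊆? A′)) ⟩
  sum (λ a → sum λ b → e a b * (B A X - indicator (swap a b X′ ⊆? A′)))
    ≡⟨ sum-cong-≗ (λ a → sum-cong-≗ λ b → cong (λ z → e a b * (B A X - z))
         (indicator-⇔ (swap a b X′ ⊆? A′) (X′ ⊆? swap a b A′)
           (λ s → swap-⊆ a b X′ A′ s) (λ s → ⊆-swap a b X′ A′ s))) ⟩
  sum (λ a → sum λ b → e a b * (B A X - indicator (X′ ⊆? swap a b A′)))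
    -- The same edge sum is read as row `A` of `L₂` acting on the function that tests containment of
    -- the fixed set `X′`; `B A X` is the base value of both functions.
    ≡⟨ laplacian-edges G σ₂ A (λ S → indicator (X′ ⊆? S)) ⟨
  + 2 * sum (λ t → L₂ A t * B t X) ∎)
  where
  L₁ = laplacian (tokenGraph G k₁) σ₁
  L₂ = laplacian (tokenGraph G k₂) σ₂
  B  = binomialMatrix n k₂ k₁ σ₂ σ₁
  A′ = proj₁ (Inverse.to σ₂ A)
  X′ = proj₁ (Inverse.to σ₁ X)
  e : Fin n → Fin n → ℤ
  e a b = indicator (Graph.adj? G a b)
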